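{- Let $A$ be a finite alphabet. The coloured non-commutative elementary symmetric functions $(E_I)$, indexed by sentences $I$ over $A$, form a linear basis of $\mathrm{NSym}_A$; in particular, for every sentence $I$, $$H_I=\sum_{J\preccurlyeq I}(-1)^{|I|-\ell(J)}E_J .$$
   Context: $\Bbbk$ is a field of characteristic zero. A sentence $I=(w_1,\dots,w_m)$ over $A$ is a finite sequence of non-empty words in letters of $A$; $1$ is the empty sentence. $\ell(I)=m$ is its length and $|I|=|w_1|+\dots+|w_m|$ its size (total number of letters). Write $J\preccurlyeq I$ ($J$ refines $I$) if the words of $I$ can be obtained by concatenating adjacent words of $J$. $\mathrm{NSym}_A$ is the $\Bbbk$-algebra with linear basis $(H_I)$ indexed by sentences over $A$, with product $H_I\cdot H_J=H_{I\cdot J}$, where $I\cdot J$ is concatenation of sequences of words. The coloured non-commutative elementary symmetric functions are $$E_I=\sum_{J\preccurlyeq I}(-1)^{|I|-\ell(J)}H_J .$$ -}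

module Defs where

open import Level using (Level; _⊔_)
open import Algebra.Bundles using (CommutativeRing; Ring)
open import Algebra.Apartness.Bundles using (HeytingField; HeytingCommutativeRing)
open import Algebra.Module.Bundles using (LeftModule)
import Algebra.Properties.Semiring.Exp as Exp
import Algebra.Properties.Semiring.Mult as Mult
import Algebra.Properties.Ring as RingProperties
open import Data.Bool.Base using (if_then_else_)
open import Data.Empty using (⊥-elim)
open import Data.Fin.Base using (Fin)
open import Data.Fin.Properties using (inj⇒≟)
open import Data.List.Base as List using (List; []; _∷_; _++_; map; concatMap; foldr; deduplicate)
import Data.List.Properties as Listₚ
open import Data.List.Membership.Propositional using (_∈_)
open import Data.List.Membership.Propositional.Properties
  using (∈-map⁺; ∈-map⁻; ∈-++⁺ˡ; ∈-++⁺ʳ; ∈-++⁻; ∈-deduplicate⁺)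
open import Data.List.NonEmpty.Base as List⁺ using (List⁺; _∷_; _⁺++_; toList)
open import Data.List.Relation.Unary.All as All using (All; []; _∷_)
open import Data.List.Relation.Unary.AllPairs using ([]; _∷_)
open import Data.List.Relation.Unary.Any using (here; there)
open import Data.List.Relation.Unary.Unique.Propositional using (Unique)
import Data.List.Relation.Unary.Unique.Propositional.Properties as Uniqueₚ
import Data.List.Relation.Unary.Unique.DecPropositional.Properties as DecUniqueₚ
open import Data.Nat.ListAction using (sum)
open import Data.Nat.Base as ℕ using (ℕ; suc; _∸_)
import Data.Nat.Properties as ℕₚ
open import Data.Product.Base using (Σ; ∃; _×_; _,_; proj₂)
open import Data.Sum.Base using (inj₁; inj₂)
open import Function.Base using (_∘_)
open import Function.Bundles using (_↔_; _⇔_; mk⇔)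
open import Function.Properties.Inverse using (↔⇒↣)
open import Relation.Binary.Definitions using (DecidableEquality)
open import Relation.Binary.PropositionalEquality as ≡ using (_≡_; _≢_)
open import Relation.Nullary.Decidable using (does; yes; no; map′)
open import Relation.Nullary.Negation using (¬_)

private
  variable
    a : Level

fieldRing : ∀ {c ℓ₁ ℓ₂} → HeytingField c ℓ₁ ℓ₂ → CommutativeRing c ℓ₁
fieldRing F = HeytingCommutativeRing.commutativeRing
  (HeytingField.heytingCommutativeRing F)

module _ {c ℓ₁ ℓ₂} (F : HeytingField c ℓ₁ ℓ₂) where

  open CommutativeRing (fieldRing F)
    using (_≈_; 0#; 1#; semiring)
  open Mult semiring renaming (_×_ to _·ℕ_)

  CharacteristicZero : Set ℓ₁
  CharacteristicZero = ∀ n → ¬ (suc n ·ℕ 1# ≈ 0#)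

module _ {r ℓr m ℓm} {R : Ring r ℓr} (M : LeftModule R m ℓm) where

  open Ring R using (Carrier; _≈_; 0#)
  open LeftModule M using (Carrierᴹ; _≈ᴹ_; _+ᴹ_; _*ₗ_; 0ᴹ)

  module _ {i} {Idx : Set i} (b : Idx → Carrierᴹ) where

    linearCombination : List (Carrier × Idx) → Carrierᴹ
    linearCombination = foldr (λ (x , k) s → x *ₗ b k +ᴹ s) 0ᴹ

    Spanning : Set (r ⊔ m ⊔ ℓm ⊔ i)
    Spanning = ∀ v → ∃ λ ts → linearCombination ts ≈ᴹ v

    -- Uniqueness of the indices makes this independence of the family
    -- rather than of its image: repeated vectors are excluded.
    LinearlyIndependent : Set (r ⊔ ℓr ⊔ ℓm ⊔ i)
    LinearlyIndependent = ∀ ts → Unique (map proj₂ ts) →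
      linearCombination ts ≈ᴹ 0ᴹ → All (λ (x , _) → x ≈ 0#) ts

    IsBasis : Set (r ⊔ ℓr ⊔ m ⊔ ℓm ⊔ i)
    IsBasis = LinearlyIndependent × Spanning

Word : Set a → Set a
Word = List⁺

Sentence : Set a → Set a
Sentence A = List (Word A)

module _ {A : Set a} where

  ℓ : Sentence A → ℕ
  ℓ = List.length

  size : Sentence A → ℕ
  size = sum ∘ map List⁺.length

  infix 4 _≼_

  -- The witness groups the words of J into consecutive non-empty blocks;
  -- joining each block gives the words of I.
  _≼_ : Sentence A → Sentence A → Set a
  J ≼ I = Σ (List (List⁺ (Word A))) λ blocks →
    concatMap toList blocks ≡ J × map List⁺.concat blocks ≡ I

  -- refineWord u xs Js lists the sentences that first split the word
  -- u xs, with no cut inside u, and then continue with a member of Js.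
  refineWord : Word A → List A → List (Sentence A) → List (Sentence A)
  refineWord u []       Js = map (u ∷_) Js
  refineWord u (x ∷ xs) Js =
    map (u ∷_) (refineWord (x ∷ []) xs Js) ++
    refineWord (u ⁺++ (x ∷ [])) xs Js

  -- Lists every J with J ≼ I exactly once: see ∈-refinements⇔ and
  -- refinements-unique.
  refinements : Sentence A → List (Sentence A)
  refinements []             = [] ∷ []
  refinements ((x ∷ xs) ∷ I) = refineWord (x ∷ []) xs (refinements I)

  private

    ++-assoc⁺ : ∀ (u : Word A) xs ys → (u ⁺++ xs) ⁺++ ys ≡ u ⁺++ (xs ++ ys)
    ++-assoc⁺ (x ∷ u) xs ys = ≡.cong (x ∷_) (Listₚ.++-assoc u xs ys)

    ++-identity⁺ : ∀ (u : Word A) → u ⁺++ [] ≡ u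
    ++-identity⁺ (x ∷ u) = ≡.cong (x ∷_) (Listₚ.++-identityʳ u)

    concat⁺ : ∀ (u v : Word A) vs →
      List⁺.concat (u ∷ v ∷ vs) ≡ u ⁺++ toList (List⁺.concat (v ∷ vs))
    concat⁺ (x ∷ u) (y ∷ v) vs = ≡.refl

    data Split (u : Word A) (xs : List A) (Js : List (Sentence A)) :
               Sentence A → Set a where
      split : ∀ {v vs J} zs → v ≡ u ⁺++ zs →
              List⁺.concat (v ∷ vs) ≡ u ⁺++ xs → J ∈ Js →
              Split u xs Js (v ∷ vs ++ J)

    split-sound : ∀ u xs Js {K} → K ∈ refineWord u xs Js → Split u xs Js K
    split-sound u [] Js K∈ with ∈-map⁻ (u ∷_) K∈
    ... | J , J∈ , ≡.refl = split [] (≡.sym (++-identity⁺ u)) ≡.refl J∈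
    split-sound u (x ∷ xs) Js K∈
      with ∈-++⁻ (map (u ∷_) (refineWord (x ∷ []) xs Js)) K∈
    split-sound u (x ∷ xs) Js K∈ | inj₁ K∈ˡ with ∈-map⁻ (u ∷_) K∈ˡ
    ... | K′ , K′∈ , ≡.refl with split-sound (x ∷ []) xs Js K′∈
    ... | split {v} {vs} zs _ eq J∈ =
      split [] (≡.sym (++-identity⁺ u))
        (≡.trans (concat⁺ u v vs) (≡.cong (λ w → u ⁺++ toList w) eq)) J∈
    split-sound u (x ∷ xs) Js K∈ | inj₂ K∈ʳ
      with split-sound (u ⁺++ (x ∷ [])) xs Js K∈ʳ
    ... | split zs eq₁ eq₂ J∈ =
      split (x ∷ zs) (≡.trans eq₁ (++-assoc⁺ u (x ∷ []) zs))
        (≡.trans eq₂ (++-assoc⁺ u (x ∷ []) xs)) J∈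

    relabel : ∀ {u v : Word A} {K : Sentence A} {Js : List (Sentence A)} →
              u ≡ v → u ∷ K ∈ Js → v ∷ K ∈ Js
    relabel ≡.refl K∈ = K∈

    split-complete : ∀ u zs vs Js {J} → J ∈ Js →
      (u ⁺++ zs) ∷ vs ++ J ∈
        refineWord u (zs ++ List.concat (map toList vs)) Js
    split-complete u [] [] Js J∈ =
      relabel (≡.sym (++-identity⁺ u)) (∈-map⁺ (u ∷_) J∈)
    split-complete u [] ((y ∷ v) ∷ vs) Js J∈ =
      relabel (≡.sym (++-identity⁺ u))
        (∈-++⁺ˡ (∈-map⁺ (u ∷_) (split-complete (y ∷ []) v vs Js J∈)))
    split-complete u (z ∷ zs) vs Js {J} J∈ =
      ∈-++⁺ʳ (map (u ∷_) _)
        (relabel (++-assoc⁺ u (z ∷ []) zs)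
          (split-complete (u ⁺++ (z ∷ [])) zs vs Js J∈))

    sound : ∀ I {J} → J ∈ refinements I → J ≼ I
    sound [] (here ≡.refl) = [] , ≡.refl , ≡.refl
    sound ((x ∷ xs) ∷ I) K∈
      with split-sound (x ∷ []) xs (refinements I) K∈
    ... | split {v} {vs} _ _ eq J∈ with sound I J∈
    ... | bs , ≡.refl , ≡.refl = (v ∷ vs) ∷ bs , ≡.refl , ≡.cong (_∷ _) eq

    complete : ∀ bs →
      concatMap toList bs ∈ refinements (map List⁺.concat bs)
    complete []                    = here ≡.refl
    complete (((x ∷ u) ∷ vs) ∷ bs) =
      split-complete (x ∷ []) u vs _ (complete bs)

    refineWord-unique : ∀ u xs {Js} → Unique Js → Unique (refineWord u xs Js)
    refineWord-unique u [] uniq = Uniqueₚ.map⁺ Listₚ.∷-injectiveʳ uniq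
    refineWord-unique u (x ∷ xs) {Js} uniq =
      Uniqueₚ.++⁺
        (Uniqueₚ.map⁺ Listₚ.∷-injectiveʳ (refineWord-unique (x ∷ []) xs uniq))
        (refineWord-unique (u ⁺++ (x ∷ [])) xs uniq)
        disjoint
      where
      absurd : ∀ (w : Word A) zs → w ≢ (w ⁺++ (x ∷ [])) ⁺++ zs
      absurd w zs eq = ℕₚ.m≢1+m+n (List⁺.length w)
        (≡.trans (≡.cong List⁺.length (≡.trans eq (++-assoc⁺ w _ zs)))
          (≡.cong suc (≡.trans (Listₚ.length-++ (List⁺.tail w))
            (ℕₚ.+-suc _ _))))

      disjoint : ∀ {K} →
        ¬ (K ∈ map (u ∷_) (refineWord (x ∷ []) xs Js) ×
           K ∈ refineWord (u ⁺++ (x ∷ [])) xs Js)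
      disjoint (p , q) with ∈-map⁻ (u ∷_) p | split-sound _ xs Js q
      ... | _ , _ , eq | split zs eq₁ _ _ =
        absurd u zs (≡.trans (≡.sym (Listₚ.∷-injectiveˡ eq)) eq₁)

  ∈-refinements⇔ : ∀ {I J} → J ∈ refinements I ⇔ J ≼ I
  ∈-refinements⇔ {I} =
    mk⇔ (sound I) λ { (bs , ≡.refl , ≡.refl) → complete bs }

  refinements-unique : ∀ I → Unique (refinements I)
  refinements-unique []             = [] ∷ []
  refinements-unique ((x ∷ xs) ∷ I) =
    refineWord-unique (x ∷ []) xs (refinements-unique I)

module NSym {c ℓ₁ ℓ₂} (F : HeytingField c ℓ₁ ℓ₂)
            {A : Set a} {n : ℕ} (A↔Fin : A ↔ Fin n) where

  open CommutativeRing (fieldRing F) hiding (zero)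
  open Exp semiring using (_^_)

  private
    module 𝕜 = RingProperties ring

  infix 4 _≟_

  _≟_ : DecidableEquality (Sentence A)
  _≟_ = Listₚ.≡-dec word≟
    where
    word≟ : DecidableEquality (Word A)
    word≟ (x ∷ xs) (y ∷ ys) =
      map′ (λ { ≡.refl → ≡.refl }) (λ { ≡.refl → ≡.refl })
        (Listₚ.≡-dec (inj⇒≟ (↔⇒↣ A↔Fin)) (x ∷ xs) (y ∷ ys))

  -- A list of terms (x , I) stands for the sum of the x H_I; terms may
  -- repeat, and equality _≋_ compares total coefficients.
  Carrierₙ : Set (a ⊔ c)
  Carrierₙ = List (Carrier × Sentence A)

  extend : (Sentence A → Carrier) → Carrierₙ → Carrier
  extend f = foldr (λ (x , I) s → x * f I + s) 0#

  δ : Sentence A → Sentence A → Carrier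
  δ K I = if does (I ≟ K) then 1# else 0#

  coeff : Carrierₙ → Sentence A → Carrier
  coeff p K = extend (δ K) p

  infix 4 _≋_

  _≋_ : Carrierₙ → Carrierₙ → Set (a ⊔ ℓ₁)
  p ≋ q = ∀ K → coeff p K ≈ coeff q K

  infixr 7 _•_
  infixl 7 _·_

  _•_ : Carrier → Carrierₙ → Carrierₙ
  x • p = map (λ (y , I) → x * y , I) p

  H : Sentence A → Carrierₙ
  H I = (1# , I) ∷ []

  _·_ : Carrierₙ → Carrierₙ → Carrierₙ
  p · q = concatMap (λ (x , I) → map (λ (y , J) → x * y , I ++ J) q) p

  open import Relation.Binary.Reasoning.Setoid setoid
  open import Algebra.Properties.CommutativeSemigroup
    (CommutativeRing.+-commutativeSemigroup (fieldRing F)) using (interchange)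
  open import Algebra.Properties.CommutativeSemigroup
    (CommutativeRing.*-commutativeSemigroup (fieldRing F)) using (x∙yz≈y∙xz)

  extend-++ : ∀ f p q → extend f (p ++ q) ≈ extend f p + extend f q
  extend-++ f []            q = sym (+-identityˡ _)
  extend-++ f ((x , I) ∷ p) q =
    trans (+-congˡ (extend-++ f p q)) (sym (+-assoc _ _ _))

  extend-• : ∀ f x p → extend f (x • p) ≈ x * extend f p
  extend-• f x []            = sym (zeroʳ x)
  extend-• f x ((y , I) ∷ p) = begin
    x * y * f I + extend f (x • p)     ≈⟨ +-cong (*-assoc _ _ _) (extend-• f x p) ⟩
    x * (y * f I) + x * extend f p     ≈⟨ distribˡ _ _ _ ⟨
    x * (y * f I + extend f p)         ∎

  extend-congᶠ : ∀ {f g} p → (∀ I → f I ≈ g I) → extend f p ≈ extend g p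
  extend-congᶠ []            f≈g = refl
  extend-congᶠ ((x , I) ∷ p) f≈g =
    +-cong (*-congˡ (f≈g I)) (extend-congᶠ p f≈g)

  extend-+ᶠ : ∀ f g p →
    extend (λ I → f I + g I) p ≈ extend f p + extend g p
  extend-+ᶠ f g []            = sym (+-identityˡ _)
  extend-+ᶠ f g ((x , I) ∷ p) =
    trans (+-cong (distribˡ _ _ _) (extend-+ᶠ f g p)) (interchange _ _ _ _)

  extend-*ᶠ : ∀ x f p → extend (λ I → x * f I) p ≈ x * extend f p
  extend-*ᶠ x f []            = sym (zeroʳ x)
  extend-*ᶠ x f ((y , I) ∷ p) =
    trans (+-cong (x∙yz≈y∙xz _ _ _) (extend-*ᶠ x f p)) (sym (distribˡ _ _ _))

  extend-· : ∀ f p q →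
    extend f (p · q) ≈ extend (λ I → extend (λ J → f (I ++ J)) q) p
  extend-· f []            q = refl
  extend-· f ((x , I) ∷ p) q =
    trans (extend-++ f (map (λ (y , J) → x * y , I ++ J) q) (p · q))
      (+-cong (row q) (extend-· f p q))
    where
    row : ∀ q → extend f (map (λ (y , J) → x * y , I ++ J) q) ≈
                x * extend (λ J → f (I ++ J)) q
    row []            = sym (zeroʳ x)
    row ((y , J) ∷ q) =
      trans (+-cong (*-assoc _ _ _) (row q)) (sym (distribˡ _ _ _))

  δ-≡ : ∀ I → δ I I ≈ 1#
  δ-≡ I with I ≟ I
  ... | yes _  = refl
  ... | no I≢I = ⊥-elim (I≢I ≡.refl)

  δ-≢ : ∀ {K I} → I ≢ K → δ K I ≈ 0#
  δ-≢ {K} {I} I≢K with I ≟ K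
  ... | yes I≡K = ⊥-elim (I≢K I≡K)
  ... | no _    = refl

  extend-H : ∀ f I → extend f (H I) ≈ f I
  extend-H f I = trans (+-identityʳ _) (*-identityˡ _)

  ∑ : List (Sentence A) → (Sentence A → Carrier) → Carrier
  ∑ L f = foldr (λ I s → f I + s) 0# L

  ∑-cong : ∀ L {f g} → (∀ I → f I ≈ g I) → ∑ L f ≈ ∑ L g
  ∑-cong []      f≈g = refl
  ∑-cong (I ∷ L) f≈g = +-cong (f≈g I) (∑-cong L f≈g)

  ∑-+ : ∀ L f g → ∑ L (λ I → f I + g I) ≈ ∑ L f + ∑ L g
  ∑-+ []      f g = sym (+-identityˡ _)
  ∑-+ (I ∷ L) f g = trans (+-congˡ (∑-+ L f g)) (interchange _ _ _ _)

  ∑-δ-∉ : ∀ L {I} x (f : Sentence A → Carrier) → All (I ≢_) L → ∑ L (λ K → x * δ K I * f K) ≈ 0#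
  ∑-δ-∉ []      x f []         = refl
  ∑-δ-∉ (K ∷ L) {I} x f (I≢K ∷ I∉) = begin
    x * δ K I * f K + _  ≈⟨ +-cong (*-congʳ (*-congˡ (δ-≢ {K} {I} I≢K))) (∑-δ-∉ L x f I∉) ⟩
    x * 0# * f K + 0#    ≈⟨ +-identityʳ _ ⟩
    x * 0# * f K         ≈⟨ *-congʳ (zeroʳ x) ⟩
    0# * f K             ≈⟨ zeroˡ _ ⟩
    0#                   ∎

  ∑-δ-∈ : ∀ {L I} x (f : Sentence A → Carrier) → Unique L → I ∈ L →
    ∑ L (λ K → x * δ K I * f K) ≈ x * f I
  ∑-δ-∈ {L = I ∷ L} x f (I∉ ∷ _) (here ≡.refl) = begin
    x * δ I I * f I + _  ≈⟨ +-cong (*-congʳ (*-congˡ (δ-≡ I))) (∑-δ-∉ L x f I∉) ⟩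
    x * 1# * f I + 0#    ≈⟨ +-identityʳ _ ⟩
    x * 1# * f I         ≈⟨ *-congʳ (*-identityʳ x) ⟩
    x * f I              ∎
  ∑-δ-∈ {L = K ∷ L} {I} x f (K∉ ∷ uniq) (there I∈) = begin
    x * δ K I * f K + _  ≈⟨ +-cong (*-congʳ (*-congˡ (δ-≢ {K} {I} (All.lookup K∉ I∈ ∘ ≡.sym)))) (∑-δ-∈ x f uniq I∈) ⟩
    x * 0# * f K + x * f I  ≈⟨ +-congʳ (trans (*-congʳ (zeroʳ x)) (zeroˡ _)) ⟩
    0# + x * f I         ≈⟨ +-identityˡ _ ⟩
    x * f I              ∎

  ∑-0 : ∀ L (f : Sentence A → Carrier) → ∑ L (λ K → 0# * f K) ≈ 0#
  ∑-0 []      f = refl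
  ∑-0 (K ∷ L) f = trans (+-cong (zeroˡ _) (∑-0 L f)) (+-identityˡ _)

  extend-coeff : ∀ {L} f p → Unique L → (∀ {I} → I ∈ map proj₂ p → I ∈ L) →
    extend f p ≈ ∑ L (λ K → coeff p K * f K)
  extend-coeff {L} f []            uniq ⊆L = sym (∑-0 L f)
  extend-coeff {L} f ((x , I) ∷ p) uniq ⊆L = begin
    x * f I + extend f p
      ≈⟨ +-cong (∑-δ-∈ x f uniq (⊆L (here ≡.refl)))
           (sym (extend-coeff f p uniq (⊆L ∘ there))) ⟨
    ∑ L (λ K → x * δ K I * f K) + ∑ L (λ K → coeff p K * f K)
      ≈⟨ ∑-+ L _ _ ⟨
    ∑ L (λ K → x * δ K I * f K + coeff p K * f K)
      ≈⟨ ∑-cong L (λ K → sym (distribʳ _ _ _)) ⟩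
    ∑ L (λ K → (x * δ K I + coeff p K) * f K)
      ∎

  -- The linear extension of f is well defined.
  extend-cong : ∀ f {p q} → p ≋ q → extend f p ≈ extend f q
  extend-cong f {p} {q} p≋q = begin
    extend f p                     ≈⟨ extend-coeff f p uniq (λ I∈ → ∈-deduplicate⁺ _≟_ (∈-++⁺ˡ I∈)) ⟩
    ∑ L (λ K → coeff p K * f K)    ≈⟨ ∑-cong L (λ K → *-congʳ (p≋q K)) ⟩
    ∑ L (λ K → coeff q K * f K)    ≈⟨ extend-coeff f q uniq (λ I∈ → ∈-deduplicate⁺ _≟_ (∈-++⁺ʳ (map proj₂ p) I∈)) ⟨
    extend f q                     ∎
    where
    L = deduplicate _≟_ (map proj₂ p ++ map proj₂ q)
    uniq : Unique L
    uniq = DecUniqueₚ.deduplicate-! _≟_ _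

  •-cong : ∀ {x y p q} → x ≈ y → p ≋ q → x • p ≋ y • q
  •-cong {x} {y} {p} {q} x≈y p≋q K =
    trans (extend-• (δ K) x p)
      (trans (*-cong x≈y (p≋q K)) (sym (extend-• (δ K) y q)))

  ++-cong : ∀ {p p′ q q′} → p ≋ p′ → q ≋ q′ → p ++ q ≋ p′ ++ q′
  ++-cong {p} {p′} {q} {q′} p≋p′ q≋q′ K =
    trans (extend-++ (δ K) p q)
      (trans (+-cong (p≋p′ K) (q≋q′ K)) (sym (extend-++ (δ K) p′ q′)))

  ++-comm : ∀ p q → p ++ q ≋ q ++ p
  ++-comm p q K = trans (extend-++ (δ K) p q)
    (trans (+-comm _ _) (sym (extend-++ (δ K) q p)))

  ≡⇒≋ : ∀ {p q} → p ≡ q → p ≋ q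
  ≡⇒≋ ≡.refl K = refl

  inverseˡ : ∀ p → (- 1#) • p ++ p ≋ []
  inverseˡ p K = begin
    coeff ((- 1#) • p ++ p) K          ≈⟨ extend-++ (δ K) ((- 1#) • p) p ⟩
    coeff ((- 1#) • p) K + coeff p K   ≈⟨ +-congʳ (extend-• (δ K) (- 1#) p) ⟩
    - 1# * coeff p K + coeff p K       ≈⟨ +-congʳ (𝕜.-1*x≈-x _) ⟩
    - coeff p K + coeff p K            ≈⟨ -‿inverseˡ _ ⟩
    0#                                 ∎

  distribᴿ : ∀ p x y → (x + y) • p ≋ x • p ++ y • p
  distribᴿ p x y K = begin
    coeff ((x + y) • p) K              ≈⟨ extend-• (δ K) (x + y) p ⟩
    (x + y) * coeff p K                ≈⟨ distribʳ _ _ _ ⟩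
    x * coeff p K + y * coeff p K      ≈⟨ +-cong (extend-• (δ K) x p) (extend-• (δ K) y p) ⟨
    coeff (x • p) K + coeff (y • p) K  ≈⟨ extend-++ (δ K) (x • p) (y • p) ⟨
    coeff (x • p ++ y • p) K           ∎

  •-assoc : ∀ x y p → (x * y) • p ≋ x • y • p
  •-assoc x y p K = begin
    coeff ((x * y) • p) K  ≈⟨ extend-• (δ K) (x * y) p ⟩
    x * y * coeff p K      ≈⟨ *-assoc _ _ _ ⟩
    x * (y * coeff p K)    ≈⟨ *-congˡ (extend-• (δ K) y p) ⟨
    x * coeff (y • p) K    ≈⟨ extend-• (δ K) x (y • p) ⟨
    coeff (x • y • p) K    ∎

  leftModule : LeftModule ring (a ⊔ c) (a ⊔ ℓ₁)
  leftModule = record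
    { Carrierᴹ = Carrierₙ
    ; _≈ᴹ_     = _≋_
    ; _+ᴹ_     = _++_
    ; _*ₗ_     = _•_
    ; 0ᴹ       = []
    ; -ᴹ_      = (- 1#) •_
    ; isLeftModule = record
      { isLeftSemimodule = record
        { +ᴹ-isCommutativeMonoid = record
          { isMonoid = record
            { isSemigroup = record
              { isMagma = record
                { isEquivalence = record
                  { refl  = λ K → refl
                  ; sym   = λ p≋q K → sym (p≋q K)
                  ; trans = λ p≋q q≋r K → trans (p≋q K) (q≋r K)
                  }
                ; ∙-cong = λ {p} {p′} {q} {q′} → ++-cong {p} {p′} {q} {q′}
                }
              ; assoc = λ p q r → ≡⇒≋ (Listₚ.++-assoc p q r)
              }
            ; identity = (λ p K → refl) , (λ p → ≡⇒≋ (Listₚ.++-identityʳ p))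
            }
          ; comm = ++-comm
          }
        ; isPreleftSemimodule = record
          { *ₗ-cong      = λ {x} {y} {p} {q} → •-cong {x} {y} {p} {q}
          ; *ₗ-zeroˡ     = λ p K → trans (extend-• (δ K) 0# p) (zeroˡ _)
          ; *ₗ-distribʳ  = distribᴿ
          ; *ₗ-identityˡ = λ p K → trans (extend-• (δ K) 1# p) (*-identityˡ _)
          ; *ₗ-assoc     = •-assoc
          ; *ₗ-zeroʳ     = λ x K → refl
          ; *ₗ-distribˡ  = λ x p q → ≡⇒≋ (Listₚ.map-++ _ p q)
          }
        }
      ; -ᴹ‿cong    = λ {p} {q} → •-cong {p = p} {q} refl
      ; -ᴹ‿inverse = inverseˡ , λ p K →
          trans (++-comm p ((- 1#) • p) K) (inverseˡ p K)
      }
    }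

  open LeftModule leftModule public
    using (_≈ᴹ_; _+ᴹ_; _*ₗ_; 0ᴹ; +ᴹ-isAbelianGroup)

  ·-cong : ∀ {p p′ q q′} → p ≋ p′ → q ≋ q′ → p · q ≋ p′ · q′
  ·-cong {p} {p′} {q} {q′} p≋p′ q≋q′ K = begin
    coeff (p · q) K                                ≈⟨ extend-· (δ K) p q ⟩
    extend (λ I → extend (λ J → δ K (I ++ J)) q) p
      ≈⟨ extend-congᶠ p (λ I → extend-cong _ {q} {q′} q≋q′) ⟩
    extend (λ I → extend (λ J → δ K (I ++ J)) q′) p
      ≈⟨ extend-cong _ {p} {p′} p≋p′ ⟩
    extend (λ I → extend (λ J → δ K (I ++ J)) q′) p′
      ≈⟨ extend-· (δ K) p′ q′ ⟨
    coeff (p′ · q′) K                              ∎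

  ·-assoc : ∀ p q r → (p · q) · r ≋ p · (q · r)
  ·-assoc p q r K = begin
    coeff ((p · q) · r) K
      ≈⟨ extend-· (δ K) (p · q) r ⟩
    extend (λ I → extend (λ J → δ K (I ++ J)) r) (p · q)
      ≈⟨ extend-· _ p q ⟩
    extend (λ I → extend (λ I′ → extend (λ J → δ K ((I ++ I′) ++ J)) r) q) p
      ≈⟨ extend-congᶠ p (λ I → extend-congᶠ q (λ I′ → extend-congᶠ r (λ J →
           reflexive (≡.cong (δ K) (Listₚ.++-assoc I I′ J))))) ⟩
    extend (λ I → extend (λ I′ → extend (λ J → δ K (I ++ (I′ ++ J))) r) q) p
      ≈⟨ extend-congᶠ p (λ I → extend-· (λ J → δ K (I ++ J)) q r) ⟨
    extend (λ I → extend (λ J → δ K (I ++ J)) (q · r)) p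
      ≈⟨ extend-· (δ K) p (q · r) ⟨
    coeff (p · (q · r)) K
      ∎

  ·-identityˡ : ∀ p → H [] · p ≋ p
  ·-identityˡ p K = trans (extend-· (δ K) (H []) p)
    (extend-H (λ I → extend (λ J → δ K (I ++ J)) p) [])

  ·-identityʳ : ∀ p → p · H [] ≋ p
  ·-identityʳ p K = trans (extend-· (δ K) p (H []))
    (extend-congᶠ p (λ I → trans (extend-H (λ J → δ K (I ++ J)) [])
      (reflexive (≡.cong (δ K) (Listₚ.++-identityʳ I)))))

  ·-distribˡ : ∀ p q r → p · (q ++ r) ≋ p · q ++ p · r
  ·-distribˡ p q r K = begin
    coeff (p · (q ++ r)) K
      ≈⟨ extend-· (δ K) p (q ++ r) ⟩
    extend (λ I → extend (λ J → δ K (I ++ J)) (q ++ r)) p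
      ≈⟨ extend-congᶠ p (λ I → extend-++ _ q r) ⟩
    extend (λ I → extend (λ J → δ K (I ++ J)) q + extend (λ J → δ K (I ++ J)) r) p
      ≈⟨ extend-+ᶠ _ _ p ⟩
    extend (λ I → extend (λ J → δ K (I ++ J)) q) p + extend (λ I → extend (λ J → δ K (I ++ J)) r) p
      ≈⟨ +-cong (extend-· (δ K) p q) (extend-· (δ K) p r) ⟨
    coeff (p · q) K + coeff (p · r) K
      ≈⟨ extend-++ (δ K) (p · q) (p · r) ⟨
    coeff (p · q ++ p · r) K
      ∎

  ·-distribʳ : ∀ p q r → (q ++ r) · p ≋ q · p ++ r · p
  ·-distribʳ p q r = ≡⇒≋ (Listₚ.concatMap-++ _ q r)

  algebraRing : Ring (a ⊔ c) (a ⊔ ℓ₁)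
  algebraRing = record
    { Carrier = Carrierₙ
    ; _≈_     = _≋_
    ; _+_     = _++_
    ; _*_     = _·_
    ; -_      = (- 1#) •_
    ; 0#      = []
    ; 1#      = H []
    ; isRing  = record
      { +-isAbelianGroup = +ᴹ-isAbelianGroup
      ; *-cong     = λ {p} {p′} {q} {q′} → ·-cong {p} {p′} {q} {q′}
      ; *-assoc    = ·-assoc
      ; *-identity = ·-identityˡ , ·-identityʳ
      ; distrib    = ·-distribˡ , ·-distribʳ
      }
    }

  •-·-assocˡ : ∀ x p q → (x • p) · q ≈ᴹ x • (p · q)
  •-·-assocˡ x p q K = begin
    coeff ((x • p) · q) K      ≈⟨ extend-· (δ K) (x • p) q ⟩
    extend _ (x • p)           ≈⟨ extend-• _ x p ⟩
    x * extend _ p             ≈⟨ *-congˡ (extend-· (δ K) p q) ⟨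
    x * coeff (p · q) K        ≈⟨ extend-• (δ K) x (p · q) ⟨
    coeff (x • (p · q)) K      ∎

  •-·-assocʳ : ∀ x p q → p · (x • q) ≈ᴹ x • (p · q)
  •-·-assocʳ x p q K = begin
    coeff (p · (x • q)) K                               ≈⟨ extend-· (δ K) p (x • q) ⟩
    extend (λ I → extend (λ J → δ K (I ++ J)) (x • q)) p ≈⟨ extend-congᶠ p (λ I → extend-• _ x q) ⟩
    extend (λ I → x * extend (λ J → δ K (I ++ J)) q) p  ≈⟨ extend-*ᶠ x _ p ⟩
    x * extend _ p                                      ≈⟨ *-congˡ (extend-· (δ K) p q) ⟨
    x * coeff (p · q) K                                 ≈⟨ extend-• (δ K) x (p · q) ⟨
    coeff (x • (p · q)) K                               ∎

  H-· : ∀ I J → H I · H J ≈ᴹ H (I ++ J)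
  H-· I J K = +-congʳ (*-congʳ (*-identityˡ _))

  linearCombination-H : ∀ p → linearCombination leftModule H p ≋ p
  linearCombination-H []            K = refl
  linearCombination-H ((x , I) ∷ p) K =
    +-cong (*-congʳ (*-identityʳ x)) (linearCombination-H p K)

  coeff-∉ : ∀ p {K} → All (K ≢_) (map proj₂ p) → coeff p K ≈ 0#
  coeff-∉ []            []         = refl
  coeff-∉ ((x , I) ∷ p) (K≢I ∷ K∉) =
    trans (+-cong (trans (*-congˡ (δ-≢ (K≢I ∘ ≡.sym))) (zeroʳ x))
      (coeff-∉ p K∉)) (+-identityˡ _)

  coeff-head : ∀ x I p → All (I ≢_) (map proj₂ p) →
    coeff ((x , I) ∷ p) I ≈ x
  coeff-head x I p I∉ =
    trans (+-cong (trans (*-congˡ (δ-≡ I)) (*-identityʳ x)) (coeff-∉ p I∉))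
      (+-identityʳ x)

  unique⇒≈0 : ∀ p → Unique (map proj₂ p) → p ≋ [] →
    All (λ (x , _) → x ≈ 0#) p
  unique⇒≈0 []            uniq        p≋0 = []
  unique⇒≈0 ((x , I) ∷ p) (I∉ ∷ uniq) p≋0 = x≈0 ∷ unique⇒≈0 p uniq λ K →
    trans (sym (trans (+-congʳ (trans (*-congʳ x≈0) (zeroˡ _)))
      (+-identityˡ _))) (p≋0 K)
    where
    x≈0 : x ≈ 0#
    x≈0 = trans (sym (coeff-head x I p I∉)) (p≋0 I)

  H-isBasis : IsBasis leftModule H
  H-isBasis =
    (λ p uniq eq → unique⇒≈0 p uniq λ K →
      trans (sym (linearCombination-H p K)) (eq K)) ,
    (λ p → p , linearCombination-H p)

  -- ∑≼ I f is the sum of f J over all J with J ≼ I.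
  ∑≼ : Sentence A → (Sentence A → Carrierₙ) → Carrierₙ
  ∑≼ I f = foldr (λ J s → f J +ᴹ s) 0ᴹ (refinements I)

  -- Truncated subtraction is harmless when J ≼ I, since then
  -- ℓ J ≤ size J = size I.
  sign : Sentence A → Sentence A → Carrier
  sign I J = (- 1#) ^ (size I ∸ ℓ J)

  E : Sentence A → Carrierₙ
  E I = ∑≼ I λ J → sign I J *ₗ H J

{-# OPTIONS --safe #-}

-- For f : Sentence A → 𝕜 let S f I be the sum of sign I J * f J over J ≼ I, so
-- that the coefficient of H K in E I is S (δ K) I.  Everything follows from
-- S (S f) = f.  Write cons x J for J with the one-letter word x put in front,
-- and join x J for J with x attached to its first word.  The refinements of
-- join x I are the sentences cons x J and join x J with J ≼ I, whence
--   S f (cons x I) = S (f ∘ cons x) I,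
--   S f (join x I) = S (f ∘ cons x) I − S (f ∘ join x) I,
-- and in S (S f) (join x I) the terms with cons x cancel.
module Submission where

open import Defs
open import Algebra.Apartness.Bundles using (HeytingField)
open import Algebra.Bundles using (CommutativeRing)
import Algebra.Properties.Ring as RingProperties
import Algebra.Properties.Semiring.Exp as Exp
open import Data.Fin.Base using (Fin)
open import Data.List.Base using ([]; _∷_; _++_; map; foldr)
open import Data.List.Membership.Propositional using (_∈_)
open import Data.List.NonEmpty.Base using (_∷_; _∷⁺_; _⁺++_)
open import Data.List.Properties using (map-++; map-∘)
open import Data.List.Relation.Unary.All as All using (All; []; _∷_)
import Data.List.Relation.Unary.All.Properties as Allₚ
open import Data.List.Relation.Unary.Any using (here; there)
open import Data.Nat.Base using (ℕ; suc; _∸_; _≤_; z≤n; s≤s)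
import Data.Nat.Properties as ℕₚ
open import Data.Product.Base using (_×_; _,_; ∃₂)
open import Function.Base using (_∘_)
open import Function.Bundles using (_↔_; Equivalence)
open import Relation.Binary.PropositionalEquality as ≡ using (_≡_)

-- Refinements when a letter is put in front.

module _ {a} {A : Set a} where

  cons : A → Sentence A → Sentence A
  cons x J = (x ∷ []) ∷ J

  -- The value at [] is irrelevant; this one makes join x preserve ℓ.
  join : A → Sentence A → Sentence A
  join x []      = []
  join x (w ∷ J) = (x ∷⁺ w) ∷ J

  -- Removing the first letter undoes `cons` if the first word has one letter, and `join` otherwise.
  sentence-ind : ∀ {p} (P : Sentence A → Set p) → P [] →
    (∀ x I → P I → P (cons x I)) →
    (∀ x w I → P (w ∷ I) → P (join x (w ∷ I))) → ∀ I → P I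
  sentence-ind P base step-cons step-join = λ where
      []             → base
      ((x ∷ xs) ∷ I) → go x xs I
    where
    go : ∀ x xs I → P ((x ∷ xs) ∷ I)
    go x []       []             = step-cons x [] base
    go x []       ((y ∷ ys) ∷ I) = step-cons x _ (go y ys I)
    go x (y ∷ ys) I              = step-join x _ I (go y ys I)

  -- The accumulated prefix `u` is never cut: it stays at the start of the first word, where `x` may
  -- as well be attached afterwards.
  refineWord-∷⁺ : ∀ x (u : Word A) ys Js →
    refineWord (x ∷⁺ u) ys Js ≡ map (join x) (refineWord u ys Js)
  refineWord-∷⁺ x u []       Js = map-∘ Js
  refineWord-∷⁺ x u (y ∷ ys) Js = ≡.trans
    (≡.cong₂ _++_ (map-∘ (refineWord (y ∷ []) ys Js))
      (refineWord-∷⁺ x (u ⁺++ (y ∷ [])) ys Js))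
    (≡.sym (map-++ (join x) (map (u ∷_) (refineWord (y ∷ []) ys Js)) _))

  -- After `x` there is either a cut or none. Unfolding `refineWord` once gives the first half; in
  -- the second, the prefix is already `x` followed by the first letter of `w`.
  refinements-join : ∀ x (w : Word A) I → refinements (join x (w ∷ I)) ≡
    map (cons x) (refinements (w ∷ I)) ++ map (join x) (refinements (w ∷ I))
  refinements-join x (y ∷ ys) I =
    ≡.cong (map (cons x) (refinements ((y ∷ ys) ∷ I)) ++_)
      (refineWord-∷⁺ x (y ∷ []) ys (refinements I))

  ℓ-join : ∀ x (J : Sentence A) → ℓ (join x J) ≡ ℓ J
  ℓ-join x []      = ≡.refl
  ℓ-join x (_ ∷ _) = ≡.refl

  -- Keeps the truncated subtraction in `sign` exact: `cons` raises both length and size by one,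
  -- `join` only the size.
  refinements-ℓ≤size : ∀ (I : Sentence A) → All (λ J → ℓ J ≤ size I) (refinements I)
  refinements-ℓ≤size = sentence-ind _ (z≤n ∷ [])
    (λ x I ih → Allₚ.map⁺ (All.map s≤s ih))
    (λ x w I ih → ≡.subst (All _) (≡.sym (refinements-join x w I))
      (Allₚ.++⁺ (Allₚ.map⁺ (All.map s≤s ih))
        (Allₚ.map⁺ (All.map
          (λ {J} ℓ≤ → ≡.subst (_≤ _) (≡.sym (ℓ-join x J)) (ℕₚ.m≤n⇒m≤1+n ℓ≤)) ih))))

  ≼-nonempty : ∀ {w : Word A} {I J} → J ≼ (w ∷ I) → ∃₂ λ v K → J ≡ v ∷ K
  ≼-nonempty ((v ∷ vs) ∷ bs , ≡.refl , _) = v , _ , ≡.refl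

module _ {c ℓ₁ ℓ₂ a} (F : HeytingField c ℓ₁ ℓ₂)
         {A : Set a} {n : ℕ} (A↔Fin : A ↔ Fin n) where

  open NSym F A↔Fin
  open CommutativeRing (fieldRing F) hiding (zero)
  open Exp semiring using (_^_)
  open RingProperties ring
    using (-0#≈0#; -1*x≈-x; -‿distribˡ-*; -‿distribʳ-*; -‿+-comm; -‿involutive)
  open import Relation.Binary.Reasoning.Setoid setoid

  -- Signed sums over refinements.

  private
    variable
      f g : Sentence A → Carrier

  ∑-cong-∈ : ∀ L → (∀ {J} → J ∈ L → f J ≈ g J) → ∑ L f ≈ ∑ L g
  ∑-cong-∈ []      f≈g = refl
  ∑-cong-∈ (J ∷ L) f≈g = +-cong (f≈g (here ≡.refl)) (∑-cong-∈ L (f≈g ∘ there))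

  ∑-++ : ∀ L L′ f → ∑ (L ++ L′) f ≈ ∑ L f + ∑ L′ f
  ∑-++ []      L′ f = sym (+-identityˡ _)
  ∑-++ (J ∷ L) L′ f = trans (+-congˡ (∑-++ L L′ f)) (sym (+-assoc _ _ _))

  ∑-map : ∀ (h : Sentence A → Sentence A) L f → ∑ (map h L) f ≈ ∑ L (f ∘ h)
  ∑-map h []      f = refl
  ∑-map h (J ∷ L) f = +-congˡ (∑-map h L f)

  ∑-neg : ∀ L f → ∑ L (λ J → - f J) ≈ - ∑ L f
  ∑-neg []      f = sym -0#≈0#
  ∑-neg (J ∷ L) f = trans (+-congˡ (∑-neg L f)) (-‿+-comm _ _)

  S : (Sentence A → Carrier) → Sentence A → Carrier
  S f I = ∑ (refinements I) λ J → sign I J * f J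

  S-cong-∈ : ∀ I → (∀ {J} → J ∈ refinements I → f J ≈ g J) → S f I ≈ S g I
  S-cong-∈ I f≈g = ∑-cong-∈ (refinements I) (*-congˡ ∘ f≈g)

  S-cong : (∀ J → f J ≈ g J) → ∀ I → S f I ≈ S g I
  S-cong f≈g I = S-cong-∈ I λ {J} _ → f≈g J

  S-minus : ∀ f g I → S (λ J → f J - g J) I ≈ S f I - S g I
  S-minus f g I = begin
    S (λ J → f J - g J) I
      ≈⟨ ∑-cong R (λ J → trans (distribˡ _ _ _)
           (+-congˡ (sym (-‿distribʳ-* (sign I J) (g J))))) ⟩
    ∑ R (λ J → sign I J * f J - sign I J * g J)
      ≈⟨ ∑-+ R _ _ ⟩
    S f I + ∑ R (λ J → - (sign I J * g J))
      ≈⟨ +-congˡ (∑-neg R _) ⟩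
    S f I - S g I
      ∎
    where
    R = refinements I

  -- A one-letter word cannot be cut, and size and length both grow by one, so no sign changes.
  S-cons : ∀ f x I → S f (cons x I) ≈ S (f ∘ cons x) I
  S-cons f x I = ∑-map (cons x) (refinements I) _

  -- Only the size grows, so the exponent rises by one; the bound rules out truncation at zero.
  sign-join : ∀ x w I J → ℓ J ≤ size (w ∷ I) →
    sign (join x (w ∷ I)) (join x J) ≈ - sign (w ∷ I) J
  sign-join x w I J ℓ≤ = trans
    (reflexive (≡.cong ((- 1#) ^_) (≡.trans
      (≡.cong (suc (size (w ∷ I)) ∸_) (ℓ-join x J)) (ℕₚ.+-∸-assoc 1 ℓ≤))))
    (-1*x≈-x _)

  S-join : ∀ f x w I →
    S f (join x (w ∷ I)) ≈ S (f ∘ cons x) (w ∷ I) - S (f ∘ join x) (w ∷ I)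
  S-join f x w I = begin
    ∑ (refinements I⁺) φ
      ≡⟨ ≡.cong (λ L → ∑ L φ) (refinements-join x w I) ⟩
    ∑ (map (cons x) R ++ map (join x) R) φ
      ≈⟨ ∑-++ (map (cons x) R) _ φ ⟩
    ∑ (map (cons x) R) φ + ∑ (map (join x) R) φ
      ≈⟨ +-cong (∑-map (cons x) R φ) (∑-map (join x) R φ) ⟩
    S (f ∘ cons x) (w ∷ I) + ∑ R (φ ∘ join x)
      ≈⟨ +-congˡ (∑-cong-∈ R λ {J} J∈ → trans
           (*-congʳ (sign-join x w I J (All.lookup (refinements-ℓ≤size (w ∷ I)) J∈)))
           (sym (-‿distribˡ-* _ _))) ⟩
    S (f ∘ cons x) (w ∷ I) + ∑ R (λ J → - (sign (w ∷ I) J * f (join x J)))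
      ≈⟨ +-congˡ (∑-neg R _) ⟩
    S (f ∘ cons x) (w ∷ I) - S (f ∘ join x) (w ∷ I)
      ∎
    where
    I⁺ = join x (w ∷ I)
    R = refinements (w ∷ I)
    φ : Sentence A → Carrier
    φ J = sign I⁺ J * f J

  -- `f` is quantified inside the induction, since the hypothesis is used at `f ∘ cons x` and at
  -- `f ∘ join x`.
  S-involutive : ∀ I f → S (S f) I ≈ f I
  S-involutive = sentence-ind _ base step-cons step-join
    where
    base : ∀ f → S (S f) [] ≈ f []
    base f = trans (S-[] (S f)) (S-[] f)
      where
      S-[] : ∀ f → S f [] ≈ f []
      S-[] f = trans (+-identityʳ _) (*-identityˡ _)

    step-cons : ∀ x I → (∀ f → S (S f) I ≈ f I) →
      ∀ f → S (S f) (cons x I) ≈ f (cons x I)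
    step-cons x I ih f = begin
      S (S f) (cons x I)      ≈⟨ S-cons (S f) x I ⟩
      S (S f ∘ cons x) I      ≈⟨ S-cong (S-cons f x) I ⟩
      S (S (f ∘ cons x)) I    ≈⟨ ih (f ∘ cons x) ⟩
      f (cons x I)            ∎

    step-join : ∀ x w I → (∀ f → S (S f) (w ∷ I) ≈ f (w ∷ I)) →
      ∀ f → S (S f) (join x (w ∷ I)) ≈ f (join x (w ∷ I))
    step-join x w I ih f = begin
      S (S f) (join x I′)
        ≈⟨ S-join (S f) x w I ⟩
      S (S f ∘ cons x) I′ - S (S f ∘ join x) I′
        ≈⟨ +-cong (S-cong (S-cons f x) I′) (-‿cong (S-cong-∈ I′ inner)) ⟩
      S (S fᶜ) I′ - S (λ J → S fᶜ J - S fʲ J) I′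
        ≈⟨ +-congˡ (-‿cong (S-minus (S fᶜ) (S fʲ) I′)) ⟩
      S (S fᶜ) I′ - (S (S fᶜ) I′ - S (S fʲ) I′)
        ≈⟨ x-[x-y]≈y _ _ ⟩
      S (S fʲ) I′
        ≈⟨ ih fʲ ⟩
      f (join x I′)
        ∎
      where
      I′ = w ∷ I
      fᶜ = f ∘ cons x
      fʲ = f ∘ join x

      -- `S-join` requires a non-empty sentence, and every refinement of the non-empty `I′` is one.
      inner : ∀ {J} → J ∈ refinements I′ → S f (join x J) ≈ S fᶜ J - S fʲ J
      inner J∈ with ≼-nonempty (Equivalence.to (∈-refinements⇔ {I = I′}) J∈)
      ... | v , K , ≡.refl = S-join f x v K

      x-[x-y]≈y : ∀ x y → x - (x - y) ≈ y
      x-[x-y]≈y x y = begin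
        x - (x - y)       ≈⟨ +-congˡ (-‿+-comm x (- y)) ⟨
        x + (- x + - - y) ≈⟨ +-assoc _ _ _ ⟨
        x - x + - - y     ≈⟨ +-cong (-‿inverseʳ x) (-‿involutive y) ⟩
        0# + y            ≈⟨ +-identityˡ y ⟩
        y                 ∎

  -- Transfer to the algebra, and the basis property.

  extend-∑≼ : ∀ f I (p : Sentence A → Carrierₙ) →
    extend f (∑≼ I λ J → sign I J *ₗ p J) ≈ S (extend f ∘ p) I
  extend-∑≼ f I p = go (refinements I)
    where
    go : ∀ L → extend f (foldr (λ J s → sign I J *ₗ p J +ᴹ s) 0ᴹ L) ≈
               ∑ L (λ J → sign I J * extend f (p J))
    go []      = refl
    go (J ∷ L) = trans (extend-++ f (sign I J • p J) _)
      (+-cong (extend-• f (sign I J) (p J)) (go L))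

  extend-E : ∀ f I → extend f (E I) ≈ S f I
  extend-E f I = trans (extend-∑≼ f I H) (S-cong (extend-H f) I)

  H-in-E : ∀ I → H I ≈ᴹ ∑≼ I (λ J → sign I J *ₗ E J)
  H-in-E I K = begin
    coeff (H I) K                             ≈⟨ extend-H (δ K) I ⟩
    δ K I                                     ≈⟨ S-involutive I (δ K) ⟨
    S (S (δ K)) I                             ≈⟨ S-cong (extend-E (δ K)) I ⟨
    S (extend (δ K) ∘ E) I                    ≈⟨ extend-∑≼ (δ K) I E ⟨
    coeff (∑≼ I (λ J → sign I J *ₗ E J)) K    ∎

  -- Reading the terms (x , I) of an element as x H I, this is the linear map H I ↦ E I.
  T : Carrierₙ → Carrierₙ
  T = linearCombination leftModule E

  -- `S` is the transpose of `T`, so that `T` inherits the involution.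
  extend-T : ∀ f p → extend f (T p) ≈ extend (S f) p
  extend-T f []            = refl
  extend-T f ((x , I) ∷ p) = trans (extend-++ f (x • E I) (T p))
    (+-cong (trans (extend-• f x (E I)) (*-congˡ (extend-E f I))) (extend-T f p))

  T-involutive : ∀ p → T (T p) ≈ᴹ p
  T-involutive p K = begin
    coeff (T (T p)) K       ≈⟨ extend-T (δ K) (T p) ⟩
    extend (S (δ K)) (T p)  ≈⟨ extend-T (S (δ K)) p ⟩
    extend (S (S (δ K))) p  ≈⟨ extend-congᶠ p (λ I → S-involutive I (δ K)) ⟩
    coeff p K               ∎

  T≈0⇒≈0 : ∀ p → T p ≈ᴹ 0ᴹ → p ≈ᴹ 0ᴹ
  T≈0⇒≈0 p Tp≈0 K = begin
    coeff p K               ≈⟨ T-involutive p K ⟨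
    coeff (T (T p)) K       ≈⟨ extend-T (δ K) (T p) ⟩
    -- `T p` and `[]` agree only in total coefficients, so this rests on `extend` being well
    -- defined.
    extend (S (δ K)) (T p)  ≈⟨ extend-cong (S (δ K)) {T p} {[]} Tp≈0 ⟩
    0#                      ∎

  E-isBasis : IsBasis leftModule E
  E-isBasis =
    (λ p uniq Tp≈0 → unique⇒≈0 p uniq (T≈0⇒≈0 p Tp≈0)) ,
    -- As `T` is its own inverse, the terms of `T p` are coordinates of `p` in the family `E`.
    (λ p → T p , T-involutive p)

proposition3p9 : ∀ {c ℓ₁ ℓ₂ a} (F : HeytingField c ℓ₁ ℓ₂) → CharacteristicZero F →
    (A : Set a) (n : ℕ) (A↔Fin : A ↔ Fin n) →
    let open NSym F A↔Fin in
    IsBasis leftModule E ×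
    (∀ (I : Sentence A) → H I ≈ᴹ ∑≼ I (λ J → sign I J *ₗ E J))
proposition3p9 F _ A n A↔Fin = E-isBasis F A↔Fin , H-in-E F A↔Fin
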